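{- There is an algorithm to decide, for a given CFSM protocol $\mathbf P$ with communication graph $(N,E)$ and a given family of recognizable relations $\mathbf R(S)\subseteq\prod_{\xi\in E}M_\xi^*$ indexed by the composite states $S\in\prod_{j\in N}K_j$ (each given effectively, e.g. as a finite union of products of regular languages specified by finite automata), whether the family is consistent with respect to $\mathbf P$.
   Context: A CFSM protocol $\mathbf P$ has a finite directed communication graph $G=(N,E)$ (edge $\xi$ has tail $-\xi$, head $+\xi$), pairwise disjoint finite message sets $M_\xi$, and for each $j\in N$ a finite state machine $F_j=(K_j,\Sigma_j,T_j,h_j)$: finite state set $K_j$, initial state $h_j$, alphabet $\Sigma_j=\{+b: b\in M_\xi,\ j=+\xi\}\cup\{ -b: b\in M_\xi,\ j=-\xi\}$, transitions $T_j\subseteq K_j\times\Sigma_j\times K_j$ ($+b$ = receive, $-b$ = send). A composite state is $S=(p_j:j\in N)$; a channel content is $C=(x_\xi:\xi\in E)$, $x_\xi\in M_\xi^*$; global states are pairs $(S,C)$. A step: some machine $F_i$ takes $p_i\xrightarrow{ -b}q_i$ with $b\in M_\beta$, $i=-\beta$, appending $b$ to the end of $x_\beta$; or takes $p_i\xrightarrow{+b}q_i$ with $b\in M_\beta$, $i=+\beta$, provided $x_\beta$ begins with $b$, removing it; all else unchanged. $\vdash^*$ means reachability by finitely many steps. A relation $\mathbf R\subseteq\prod_{\xi\in E}M_\xi^*$ is recognizable if it is a finite union of sets $\prod_{\xi\in E}L_\xi$ with each $L_\xi\subseteq M_\xi^*$ regular. A family $\mathbf R(S)$ is consistent (with respect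 to $\mathbf P$) if $(S,C)\vdash^*(S',C')$ and $C\in\mathbf R(S)$ imply $C'\in\mathbf R(S')$. -}

module Defs where

open import Data.Fin.Base using (Fin)
open import Data.Fin.Subset using (Subset) renaming (_∈_ to _∈ₛ_)
open import Data.List.Base using (List; []; _∷_; _∷ʳ_)
open import Data.List.Membership.Propositional using () renaming (_∈_ to _∈ₗ_)
open import Data.Nat.Base using (ℕ)
open import Data.Product.Base using (Σ-syntax; ∃-syntax; _×_; _,_)
open import Data.Vec.Base using (Vec; lookup)
open import Data.Vec.Relation.Unary.All using (All)
open import Data.Vec.Relation.Unary.All.Properties using (lookup⁺)
open import Level using (0ℓ)
open import Relation.Binary.Construct.Closure.ReflexiveTransitive using (Star)
open import Relation.Binary.Core using (Rel)
open import Relation.Binary.PropositionalEquality.Core using (_≡_; _≢_)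
open import Relation.Unary using (Pred; _≐_)

Language : Set → Set₁
Language A = Pred (List A) 0ℓ

record NFA (A : Set) : Set where
  field
    size    : ℕ
    initial : Subset size
    δ       : Fin size → A → Subset size
    final   : Subset size

  AcceptsFrom : Fin size → Language A
  AcceptsFrom q []      = q ∈ₛ final
  AcceptsFrom q (a ∷ w) = ∃[ q′ ] (q′ ∈ₛ δ q a × AcceptsFrom q′ w)

  Accepts : Language A
  Accepts w = ∃[ q ] (q ∈ₛ initial × AcceptsFrom q w)

Regular : {A : Set} → Language A → Set
Regular {A} L = Σ[ 𝒜 ∈ NFA A ] L ≐ NFA.Accepts 𝒜

-- Nodes, edges, messages and states are numbered. The message sets of
-- different edges are kept disjoint because a message only ever occurs
-- together with the edge it belongs to. Parallel edges and loops are
-- allowed.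

record Network : Set where
  field
    ∣N∣ ∣E∣ : ℕ

  Node : Set
  Node = Fin ∣N∣

  Edge : Set
  Edge = Fin ∣E∣

  field
    tail head : Edge → Node
    ∣M∣       : Vec ℕ ∣E∣

  Message : Edge → Set
  Message ξ = Fin (lookup ∣M∣ ξ)

  data Action (j : Node) : Set where
    recv : (ξ : Edge) → j ≡ head ξ → Message ξ → Action j
    send : (ξ : Edge) → j ≡ tail ξ → Message ξ → Action j

UnchangedExceptAt : {n : ℕ} {A : Fin n → Set} → Fin n → Rel ((k : Fin n) → A k) 0ℓ
UnchangedExceptAt i f g = ∀ k → k ≢ i → g k ≡ f k

record Protocol : Set where
  field
    network : Network

  open Network network public

  field
    ∣K∣ : Vec ℕ ∣N∣

  State : Node → Set
  State j = Fin (lookup ∣K∣ j)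

  field
    T : (j : Node) → List (State j × Action j × State j)
    h : (j : Node) → State j

  -- Elements of ∏ⱼ Kⱼ and ∏_ξ M_ξ* are tuples rather than functions, so
  -- that tuples with equal components are propositionally equal.

  CompositeState : Set
  CompositeState = All Fin ∣K∣

  ChannelContent : Set
  ChannelContent = All (λ m → List (Fin m)) ∣M∣

  state : CompositeState → (j : Node) → State j
  state = lookup⁺

  content : ChannelContent → (ξ : Edge) → List (Message ξ)
  content = lookup⁺

  GlobalState : Set
  GlobalState = CompositeState × ChannelContent

  data _⊢_ : Rel GlobalState 0ℓ where

    send-step : ∀ {S C S′ C′} (i : Node) (β : Edge) (i≡-β : i ≡ tail β) (b : Message β) →
      (state S i , send β i≡-β b , state S′ i) ∈ₗ T i →
      UnchangedExceptAt i (state S) (state S′) →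
      content C′ β ≡ content C β ∷ʳ b →
      UnchangedExceptAt β (content C) (content C′) →
      (S , C) ⊢ (S′ , C′)

    recv-step : ∀ {S C S′ C′} (i : Node) (β : Edge) (i≡+β : i ≡ head β) (b : Message β) →
      (state S i , recv β i≡+β b , state S′ i) ∈ₗ T i →
      UnchangedExceptAt i (state S) (state S′) →
      content C β ≡ b ∷ content C′ β →
      UnchangedExceptAt β (content C) (content C′) →
      (S , C) ⊢ (S′ , C′)

  _⊢*_ : Rel GlobalState 0ℓ
  _⊢*_ = Star _⊢_

  ChannelRelation : Set₁
  ChannelRelation = Pred ChannelContent 0ℓ

  Recognizable : ChannelRelation → Set₁
  Recognizable R =
    Σ[ n ∈ ℕ ] Σ[ L ∈ (Fin n → (ξ : Edge) → Language (Message ξ)) ]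
      (∀ k ξ → Regular (L k ξ)) ×
      R ≐ (λ C → ∃[ k ] (∀ ξ → L k ξ (content C ξ)))

  Consistent : (CompositeState → ChannelRelation) → Set
  Consistent R = ∀ {S C S′ C′} → (S , C) ⊢* (S′ , C′) → R S C → R S′ C′

{-# OPTIONS --safe #-}
module Submission where

-- It suffices to test single steps. A single step from S to S′ preserves R iff
-- R S C implies R S′ C′ for all contents C, C′, one of which arises from the
-- other by appending or prepending a fixed message on one channel. As a
-- condition on one content, this is saturated by a congruence of finite index
-- in each channel (as in the Myhill–Nerode theorem), and by the pigeonhole
-- principle every class contains a word no longer than the index. Hence finitely
-- many contents need to be tested.

open import Defs
open import Data.Fin.Base using (Fin; zero; suc; toℕ; combine; funToFin; finToFun)
open import Data.Fin.Patterns using (0F; 1F)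
open import Data.Fin.Properties using (_≟_; all?; any?; pigeonhole; combine-injectiveˡ; combine-injectiveʳ; finToFun-funToFin; toℕ<n)
open import Data.Fin.Subset.Properties using (_∈?_)
open import Data.List.Base using (List; []; _∷_; _∷ʳ_; _++_; length; take; drop)
open import Data.List.Membership.Propositional using () renaming (_∈_ to _∈ₗ_)
open import Data.List.Properties using (length-++; length-take; length-drop; take++drop≡id)
open import Data.List.Relation.Unary.All as ListAll using ()
open import Data.Nat.Base using (ℕ; zero; suc; _+_; _*_; _^_; _∸_; _≤_; _<_; z≤n; s≤s)
open import Data.Nat.Properties using (_≤?_; ≰⇒>; ≤-pred; ≤-trans; <⇒≤; m⊓n≤m; m+[n∸m]≡n; +-monoˡ-≤; +-monoˡ-<; module ≤-Reasoning)
open import Data.Product.Base using (Σ-syntax; ∃-syntax; _×_; _,_; proj₁; proj₂)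
open import Data.Vec.Base using (Vec; []; _∷_; lookup)
open import Data.Vec.Relation.Unary.All using (All; []; _∷_)
open import Data.Vec.Relation.Unary.All.Properties using (lookup⁺; lookup⁻)
open import Function.Base using (_∘_; id)
open import Level using (0ℓ)
open import Relation.Binary.Construct.Closure.ReflexiveTransitive using (ε; _◅_)
open import Relation.Binary.Core using (Rel)
open import Relation.Binary.Definitions using (_Respects_)
open import Relation.Binary.PropositionalEquality using (_≡_; _≢_; refl; sym; trans; cong; cong₂; subst)
open import Relation.Nullary.Decidable using (Dec; yes; no; map′; _×-dec_; _→-dec_; ¬?)
open import Relation.Nullary.Negation using (contradiction)
open import Relation.Unary using (Pred; Decidable)

-- Left congruences of finite index

-- The congruence is given by its class map into a finite type, so the pigeonhole principle applies
-- directly. The map need not be onto, so `index` is an upper bound on the number of classes.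
record LeftCongruence (A : Set) : Set where
  infix 4 _∼_
  field
    index : ℕ
    class : List A → Fin index

  _∼_ : Rel (List A) 0ℓ
  v ∼ w = class v ≡ class w

  field
    ∷-cong : ∀ a {v w} → v ∼ w → a ∷ v ∼ a ∷ w

  ++-congˡ : ∀ u {v w} → v ∼ w → u ++ v ∼ u ++ w
  ++-congˡ []      v∼w = v∼w
  ++-congˡ (a ∷ u) v∼w = ∷-cong a (++-congˡ u v∼w)

  -- A pumping argument on suffixes: two of the nonempty suffixes of `w` share a class, and cutting
  -- out the segment between their starting points keeps the class, since restoring the common
  -- prefix respects `∼`.
  shorten : ∀ w → index < length w → ∃[ v ] (length v < length w × v ∼ w)
  shorten w index<∣w∣
    with i , j , i<j , same ← pigeonhole index<∣w∣ (λ k → class (drop (toℕ k) w))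
    = take (toℕ i) w ++ drop (toℕ j) w , shorter
    , trans (++-congˡ (take (toℕ i) w) (sym same)) (cong class (take++drop≡id (toℕ i) w))
    where
    open ≤-Reasoning
    shorter : length (take (toℕ i) w ++ drop (toℕ j) w) < length w
    shorter = begin-strict
      length (take (toℕ i) w ++ drop (toℕ j) w)         ≡⟨ length-++ (take (toℕ i) w) ⟩
      length (take (toℕ i) w) + length (drop (toℕ j) w) ≡⟨ cong₂ _+_ (length-take (toℕ i) w) (length-drop (toℕ j) w) ⟩
      _ + (length w ∸ toℕ j)                            ≤⟨ +-monoˡ-≤ _ (m⊓n≤m (toℕ i) (length w)) ⟩
      toℕ i + (length w ∸ toℕ j)                        <⟨ +-monoˡ-< _ i<j ⟩
      toℕ j + (length w ∸ toℕ j)                        ≡⟨ m+[n∸m]≡n (<⇒≤ (toℕ<n j)) ⟩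
      length w                                          ∎

  shortRepresentative : ∀ w → ∃[ v ] (length v ≤ index × v ∼ w)
  shortRepresentative []      = [] , z≤n , refl
  shortRepresentative (a ∷ w) with v , ∣v∣≤index , v∼w ← shortRepresentative w
    with suc (length v) ≤? index
  ... | yes short = a ∷ v , short , ∷-cong a v∼w
  -- One cut suffices: `a ∷ v` exceeds the bound by one letter at most, so anything strictly shorter
  -- is no longer than `v`.
  ... | no  long with u , ∣u∣<1+∣v∣ , u∼av ← shorten (a ∷ v) (≰⇒> long)
    = u , ≤-trans (≤-pred ∣u∣<1+∣v∣) ∣v∣≤index , trans u∼av (∷-cong a v∼w)

open LeftCongruence

full : {A : Set} → LeftCongruence A
full .index      = 1
full .class _    = zero
full .∷-cong _ _ = refl

_⊓_ : {A : Set} → LeftCongruence A → LeftCongruence A → LeftCongruence A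
(c ⊓ d) .index        = index c * index d
(c ⊓ d) .class w      = combine (class c w) (class d w)
(c ⊓ d) .∷-cong a v∼w = cong₂ combine
  (∷-cong c a (combine-injectiveˡ _ _ _ _ v∼w))
  (∷-cong d a (combine-injectiveʳ (class c _) _ (class c _) _ v∼w))

⊓-projˡ : {A : Set} (c d : LeftCongruence A) {v w : List A} → _∼_ (c ⊓ d) v w → _∼_ c v w
⊓-projˡ c d = combine-injectiveˡ _ _ _ _

⊓-projʳ : {A : Set} (c d : LeftCongruence A) {v w : List A} → _∼_ (c ⊓ d) v w → _∼_ d v w
⊓-projʳ c d {v} {w} = combine-injectiveʳ (class c v) _ (class c w) _

⨅ : {A : Set} {n : ℕ} → (Fin n → LeftCongruence A) → LeftCongruence A
⨅ {n = zero}  c = full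
⨅ {n = suc n} c = c zero ⊓ ⨅ (c ∘ suc)

⨅-proj : {A : Set} {n : ℕ} (c : Fin n → LeftCongruence A) (k : Fin n) {v w : List A} →
  _∼_ (⨅ c) v w → _∼_ (c k) v w
⨅-proj c zero    v∼w = ⊓-projˡ (c zero) (⨅ (c ∘ suc)) v∼w
⨅-proj c (suc k) v∼w = ⨅-proj (c ∘ suc) k (⊓-projʳ (c zero) (⨅ (c ∘ suc)) v∼w)

-- The inverse image of a congruence under `g` need not be a left congruence; it is enough that it
-- contains one of finite index. This is what carries saturation from `R` over to
-- `R ∘ mapChannels g`.
ReflectsFiniteIndex : {A : Set} → (List A → List A) → Set
ReflectsFiniteIndex {A} g =
  (c : LeftCongruence A) → Σ[ d ∈ LeftCongruence A ] (∀ {v w} → _∼_ d v w → _∼_ c (g v) (g w))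

id-reflects : {A : Set} → ReflectsFiniteIndex {A} id
id-reflects c = c , id

∷-reflects : {A : Set} (b : A) → ReflectsFiniteIndex (b ∷_)
∷-reflects b c = c , ∷-cong c b

-- Appending on the right commutes with prepending, so here the inverse image is itself a left
-- congruence, with the same index.
∷ʳ-reflects : {A : Set} (b : A) → ReflectsFiniteIndex (_∷ʳ b)
∷ʳ-reflects b c = d , id
  where
  d : LeftCongruence _
  d .index        = index c
  d .class w      = class c (w ∷ʳ b)
  d .∷-cong a v∼w = ∷-cong c a v∼w

-- Regular languages

indicator : {P : Set} → Dec P → Fin 2
indicator (yes _) = 1F
indicator (no  _) = 0F

indicator-≡⇒→ : {P Q : Set} (P? : Dec P) (Q? : Dec Q) → indicator P? ≡ indicator Q? → P → Q
indicator-≡⇒→ _       (yes q) _  _ = q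
indicator-≡⇒→ (no ¬p) (no _)  _  p = contradiction p ¬p
indicator-≡⇒→ (yes _) (no _)  ()

indicator-cong : {P Q : Set} (P? : Dec P) (Q? : Dec Q) → (P → Q) → (Q → P) → indicator P? ≡ indicator Q?
indicator-cong (yes _) (yes _) _   _   = refl
indicator-cong (no _)  (no _)  _   _   = refl
indicator-cong (yes p) (no ¬q) p→q _   = contradiction (p→q p) ¬q
indicator-cong (no ¬p) (yes q) _   q→p = contradiction (q→p q) ¬p

funToFin-cong : {m n : ℕ} {f g : Fin m → Fin n} → (∀ i → f i ≡ g i) → funToFin f ≡ funToFin g
funToFin-cong {zero}  f≗g = refl
funToFin-cong {suc m} f≗g = cong₂ combine (f≗g zero) (funToFin-cong (f≗g ∘ suc))

funToFin-injective : {m n : ℕ} {f g : Fin m → Fin n} → funToFin f ≡ funToFin g → ∀ i → f i ≡ g i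
funToFin-injective {f = f} {g} eq i =
  trans (sym (finToFun-funToFin f i)) (trans (cong (λ k → finToFun k i) eq) (finToFun-funToFin g i))

module _ {A : Set} (𝒜 : NFA A) where
  open NFA 𝒜

  acceptsFrom? : ∀ q → Decidable (AcceptsFrom q)
  acceptsFrom? q []      = q ∈? final
  acceptsFrom? q (a ∷ w) = any? λ q′ → (q′ ∈? δ q a) ×-dec acceptsFrom? q′ w

  accepts? : Decidable Accepts
  accepts? w = any? λ q → (q ∈? initial) ×-dec acceptsFrom? q w

  -- This is the state reached by the powerset automaton that starts from `final` and reads `w` from
  -- right to left along reversed transitions, with subsets coded as numbers.
  acceptingStates : List A → Fin (2 ^ size)
  acceptingStates w = funToFin λ q → indicator (acceptsFrom? q w)

  acceptingStates-≡⇒⊆ : ∀ {v w} → acceptingStates v ≡ acceptingStates w → ∀ q → AcceptsFrom q v → AcceptsFrom q w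
  acceptingStates-≡⇒⊆ {v} {w} eq q =
    indicator-≡⇒→ (acceptsFrom? q v) (acceptsFrom? q w) (funToFin-injective eq q)

  acceptsFrom-∷ : ∀ a {v w} → (∀ q → AcceptsFrom q v → AcceptsFrom q w) →
    ∀ q → AcceptsFrom q (a ∷ v) → AcceptsFrom q (a ∷ w)
  acceptsFrom-∷ a v⊆w q (q′ , q→q′ , acc) = q′ , q→q′ , v⊆w q′ acc

  -- Which states accept `a ∷ w` depends on `w` only through the set of states that accept `w`.
  nerode : LeftCongruence A
  nerode .index  = 2 ^ size
  nerode .class  = acceptingStates
  nerode .∷-cong a {v} {w} v∼w = funToFin-cong λ q →
    indicator-cong (acceptsFrom? q (a ∷ v)) (acceptsFrom? q (a ∷ w))
      (acceptsFrom-∷ a {v} {w} (acceptingStates-≡⇒⊆ v∼w) q)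
      (acceptsFrom-∷ a {w} {v} (acceptingStates-≡⇒⊆ (sym v∼w)) q)

  accepts-resp : Accepts Respects _∼_ nerode
  accepts-resp v∼w (q , q∈initial , acc) = q , q∈initial , acceptingStates-≡⇒⊆ v∼w q acc

-- Deciding universal quantification modulo an equivalence

-- Restricting to predicates that respect `≈` allows an infinite type to be settled by testing
-- finitely many representatives.
Exhaustible : (A : Set) → Rel A 0ℓ → Set₁
Exhaustible A _≈_ = {P : Pred A 0ℓ} → P Respects _≈_ → Decidable P → Dec (∀ x → P x)

Pointwise : {A : Set} {F : A → Set} {n : ℕ} {xs : Vec A n} →
  ((i : Fin n) → Rel (F (lookup xs i)) 0ℓ) → Rel (All F xs) 0ℓ
Pointwise ≈ s t = ∀ i → ≈ i (lookup⁺ s i) (lookup⁺ t i)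

-- The components are treated one at a time: the statement quantified over the remaining components
-- is decidable by recursion and again respects `≈` in the first. Reflexivity covers the components
-- held fixed.
All-exhaustible : {A : Set} {F : A → Set} {n : ℕ} {xs : Vec A n}
  (≈ : (i : Fin n) → Rel (F (lookup xs i)) 0ℓ) → (∀ i {x} → ≈ i x x) →
  (∀ i → Exhaustible (F (lookup xs i)) (≈ i)) → Exhaustible (All F xs) (Pointwise ≈)
All-exhaustible {xs = []} ≈ ≈-refl exh P-resp P? = map′ (λ { p [] → p }) (λ f → f []) (P? [])
All-exhaustible {xs = _ ∷ _} ≈ ≈-refl exh {P} P-resp P? =
  map′ (λ { f (x ∷ s) → f x s }) (λ f x s → f (x ∷ s))
    (exh zero {λ x → ∀ s → P (x ∷ s)}
      (λ x≈y f s → P-resp (λ { zero → x≈y ; (suc i) → ≈-refl (suc i) }) (f s))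
      (λ x → All-exhaustible (≈ ∘ suc) (≈-refl ∘ suc) (exh ∘ suc)
        (λ s≈t → P-resp λ { zero → ≈-refl zero ; (suc i) → s≈t i })
        (λ s → P? (x ∷ s))))

lookup⁺-injective : {A : Set} {F : A → Set} {n : ℕ} {xs : Vec A n} {s t : All F xs} →
  (∀ i → lookup⁺ s i ≡ lookup⁺ t i) → s ≡ t
lookup⁺-injective {s = []}    {[]}    eq = refl
lookup⁺-injective {s = _ ∷ _} {_ ∷ _} eq = cong₂ _∷_ (eq zero) (lookup⁺-injective (eq ∘ suc))

lookup⁺∘lookup⁻ : {A : Set} (F : A → Set) {n : ℕ} (xs : Vec A n)
  (f : ∀ i → F (lookup xs i)) → ∀ i → lookup⁺ {P = F} {xs = xs} (lookup⁻ f) i ≡ f i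
lookup⁺∘lookup⁻ F (_ ∷ _)  f zero    = refl
lookup⁺∘lookup⁻ F (_ ∷ xs) f (suc i) = lookup⁺∘lookup⁻ F xs (f ∘ suc) i

tuple-all? : {n : ℕ} {ks : Vec ℕ n} {P : Pred (All Fin ks) 0ℓ} → Decidable P → Dec (∀ s → P s)
tuple-all? {P = P} = All-exhaustible (λ _ → _≡_) (λ _ → refl) (λ _ _ → all?)
  (λ eq → subst P (lookup⁺-injective eq))

shortWords-all? : {m : ℕ} {P : Pred (List (Fin m)) 0ℓ} → Decidable P →
  ∀ n → Dec (∀ w → length w ≤ n → P w)
shortWords-all? P? zero    = map′ (λ { p [] _ → p }) (λ f → f [] z≤n) (P? [])
shortWords-all? P? (suc n) =
  map′ (λ { (p , f) [] _ → p ; (p , f) (a ∷ w) (s≤s ∣w∣≤n) → f a w ∣w∣≤n })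
       (λ f → f [] z≤n , λ a w ∣w∣≤n → f (a ∷ w) (s≤s ∣w∣≤n))
       (P? [] ×-dec all? λ a → shortWords-all? (λ w → P? (a ∷ w)) n)

words-exhaustible : {m : ℕ} (c : LeftCongruence (Fin m)) → Exhaustible (List (Fin m)) (_∼_ c)
words-exhaustible c P-resp P? = map′ extend (λ f w _ → f w) (shortWords-all? P? (index c))
  where
  extend : (∀ v → length v ≤ index c → _) → ∀ w → _
  extend f w with v , short , v∼w ← shortRepresentative c w = P-resp v∼w (f v short)

-- Relations of finite index

record FiniteIndex {n : ℕ} {ms : Vec ℕ n} (R : Pred (All (λ m → List (Fin m)) ms) 0ℓ) : Set where
  field
    congruence : ∀ ξ → LeftCongruence (Fin (lookup ms ξ))
    respects   : R Respects Pointwise (λ ξ → _∼_ (congruence ξ))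
    decide     : Decidable R

  all-contents? : Dec (∀ C → R C)
  all-contents? = All-exhaustible (λ ξ → _∼_ (congruence ξ)) (λ _ → refl)
    (λ ξ → words-exhaustible (congruence ξ)) respects decide

  respects-≡ : R Respects Pointwise (λ _ → _≡_)
  respects-≡ C≡D = respects λ ξ → cong (class (congruence ξ)) (C≡D ξ)

open FiniteIndex

-- Saturation survives in the premise because class equality is symmetric: the premise is carried
-- back from `D` to `C`, and the conclusion forward.
⇒-finiteIndex : {n : ℕ} {ms : Vec ℕ n} {R R′ : Pred (All (λ m → List (Fin m)) ms) 0ℓ} →
  FiniteIndex R → FiniteIndex R′ → FiniteIndex (λ C → R C → R′ C)
⇒-finiteIndex F F′ .congruence ξ = congruence F ξ ⊓ congruence F′ ξ
⇒-finiteIndex F F′ .respects C∼D R⇒R′ RD =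
  respects F′ (λ ξ → ⊓-projʳ (congruence F ξ) (congruence F′ ξ) (C∼D ξ))
    (R⇒R′ (respects F (λ ξ → sym (⊓-projˡ (congruence F ξ) (congruence F′ ξ) (C∼D ξ))) RD))
⇒-finiteIndex F F′ .decide C = decide F C →-dec decide F′ C

mapChannels : {n : ℕ} {ms : Vec ℕ n} → (∀ ξ → List (Fin (lookup ms ξ)) → List (Fin (lookup ms ξ))) →
  All (λ m → List (Fin m)) ms → All (λ m → List (Fin m)) ms
mapChannels g C = lookup⁻ λ ξ → g ξ (lookup⁺ C ξ)

lookup-mapChannels : {n : ℕ} {ms : Vec ℕ n} (g : ∀ ξ → List (Fin (lookup ms ξ)) → List (Fin (lookup ms ξ)))
  (C : All (λ m → List (Fin m)) ms) → ∀ ξ → lookup⁺ (mapChannels g C) ξ ≡ g ξ (lookup⁺ C ξ)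
lookup-mapChannels {ms = ms} g C = lookup⁺∘lookup⁻ (λ m → List (Fin m)) ms λ ξ → g ξ (lookup⁺ C ξ)

mapChannels-finiteIndex : {n : ℕ} {ms : Vec ℕ n} {R : Pred (All (λ m → List (Fin m)) ms) 0ℓ}
  {g : ∀ ξ → List (Fin (lookup ms ξ)) → List (Fin (lookup ms ξ))} →
  (∀ ξ → ReflectsFiniteIndex (g ξ)) → FiniteIndex R → FiniteIndex (R ∘ mapChannels g)
mapChannels-finiteIndex g-reflects F .congruence ξ = proj₁ (g-reflects ξ (congruence F ξ))
mapChannels-finiteIndex {g = g} g-reflects F .respects {C} {D} C∼D =
  respects F λ ξ → trans (cong (class (congruence F ξ)) (lookup-mapChannels g C ξ))
    (trans (proj₂ (g-reflects ξ (congruence F ξ)) (C∼D ξ))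
      (sym (cong (class (congruence F ξ)) (lookup-mapChannels g D ξ))))
mapChannels-finiteIndex {g = g} g-reflects F .decide C = decide F (mapChannels g C)

applyAt : {n : ℕ} {A : Fin n → Set} (β : Fin n) → (A β → A β) → ∀ ξ → A ξ → A ξ
applyAt β g ξ x with ξ ≟ β
... | yes refl = g x
... | no  _    = x

applyAt-≡ : {n : ℕ} {A : Fin n → Set} (β : Fin n) (g : A β → A β) (x : A β) →
  applyAt {A = A} β g β x ≡ g x
applyAt-≡ β g x with β ≟ β
... | yes refl = refl
... | no  β≢β  = contradiction refl β≢β

applyAt-≢ : {n : ℕ} {A : Fin n → Set} (β : Fin n) (g : A β → A β) {ξ : Fin n} (x : A ξ) → ξ ≢ β →
  applyAt {A = A} β g ξ x ≡ x
applyAt-≢ β g {ξ} x ξ≢β with ξ ≟ β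
... | yes ξ≡β = contradiction ξ≡β ξ≢β
... | no  _   = refl

applyAt-reflects : {n : ℕ} {A : Fin n → Set} (β : Fin n) {g : List (A β) → List (A β)} →
  ReflectsFiniteIndex g → ∀ ξ → ReflectsFiniteIndex (applyAt {A = List ∘ A} β g ξ)
applyAt-reflects β g-reflects ξ with ξ ≟ β
... | yes refl = g-reflects
... | no  _    = id-reflects

-- Protocols: recognizable relations and single-step consistency

module _ (P : Protocol) where
  open Protocol P

  -- On each channel the Nerode congruences of all `n` products are intersected, so equivalent
  -- contents lie in the same products. Membership is decided by running the automata.
  recognizable⇒finiteIndex : {R : ChannelRelation} → Recognizable R → FiniteIndex R
  recognizable⇒finiteIndex (n , L , reg , R⊆ , ⊆R) = record
    { congruence = λ ξ → ⨅ λ k → nerode (proj₁ (reg k ξ))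
    ; respects   = λ C∼D RC → let k , C∈L = R⊆ RC in
        ⊆R (k , λ ξ → let 𝒜 , L⊆ , ⊆L = reg k ξ in
          ⊆L (accepts-resp 𝒜 (⨅-proj (λ k → nerode (proj₁ (reg k ξ))) k (C∼D ξ)) (L⊆ (C∈L ξ))))
    ; decide     = λ C → map′ ⊆R R⊆ (any? λ k → all? λ ξ → let 𝒜 , L⊆ , ⊆L = reg k ξ in
        map′ ⊆L L⊆ (accepts? 𝒜 (content C ξ)))
    }

  modifyAt : (β : Edge) → (List (Message β) → List (Message β)) → ChannelContent → ChannelContent
  modifyAt β g = mapChannels (applyAt {A = List ∘ Message} β g)

  modifyAt-finiteIndex : {R : ChannelRelation} (β : Edge) {g : List (Message β) → List (Message β)} →
    ReflectsFiniteIndex g → FiniteIndex R → FiniteIndex (R ∘ modifyAt β g)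
  modifyAt-finiteIndex β g-reflects = mapChannels-finiteIndex (applyAt-reflects {A = Message} β g-reflects)

  content-modifyAt : ∀ β g C → content (modifyAt β g C) β ≡ g (content C β)
  content-modifyAt β g C =
    trans (lookup-mapChannels (applyAt {A = List ∘ Message} β g) C β) (applyAt-≡ {A = List ∘ Message} β g (content C β))

  modifyAt-unchanged : ∀ β g C → UnchangedExceptAt β (content C) (content (modifyAt β g C))
  modifyAt-unchanged β g C ξ ξ≢β =
    trans (lookup-mapChannels (applyAt {A = List ∘ Message} β g) C ξ) (applyAt-≢ {A = List ∘ Message} β g (content C ξ) ξ≢β)

  modifyAt-unique : ∀ β g C D → content D β ≡ g (content C β) → UnchangedExceptAt β (content C) (content D) →
    ∀ ξ → content (modifyAt β g C) ξ ≡ content D ξ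
  modifyAt-unique β g C D at-β elsewhere ξ with ξ ≟ β
  ... | yes refl = trans (content-modifyAt β g C) (sym at-β)
  ... | no  ξ≢β  = trans (modifyAt-unchanged β g C ξ ξ≢β) (sym (elsewhere ξ ξ≢β))

  module _ (R : CompositeState → ChannelRelation) where

    -- A receive is indexed by the content after the step. Deleting a first letter, a partial
    -- operation, thus becomes prepending, which is total and reflects finite index.
    ActionPreserves : {i : Node} → CompositeState → CompositeState → Action i → Set
    ActionPreserves S S′ (send β _ b) = ∀ C → R S C → R S′ (modifyAt β (_∷ʳ b) C)
    ActionPreserves S S′ (recv β _ b) = ∀ C → R S (modifyAt β (b ∷_) C) → R S′ C

    TransitionPreserves : (i : Node) → CompositeState → CompositeState → State i × Action i × State i → Set
    TransitionPreserves i S S′ (p , α , q) =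
      p ≡ state S i → q ≡ state S′ i → UnchangedExceptAt i (state S) (state S′) → ActionPreserves S S′ α

    StepConsistent : Set
    StepConsistent = ∀ S S′ i → ListAll.All (TransitionPreserves i S S′) (T i)

    module _ (F : ∀ S → FiniteIndex (R S)) where

      actionPreserves? : ∀ {i} S S′ (α : Action i) → Dec (ActionPreserves S S′ α)
      actionPreserves? S S′ (send β _ b) =
        all-contents? (⇒-finiteIndex (F S) (modifyAt-finiteIndex β (∷ʳ-reflects b) (F S′)))
      actionPreserves? S S′ (recv β _ b) =
        all-contents? (⇒-finiteIndex (modifyAt-finiteIndex β (∷-reflects b) (F S)) (F S′))

      stepConsistent? : Dec StepConsistent
      stepConsistent? = tuple-all? λ S → tuple-all? λ S′ → all? λ i → ListAll.all?
        (λ (p , α , q) →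
          (p ≟ state S i) →-dec (q ≟ state S′ i) →-dec
          all? (λ k → ¬? (k ≟ i) →-dec (state S′ k ≟ state S k)) →-dec
          actionPreserves? S S′ α)
        (T i)

      stepConsistent⇒consistent : StepConsistent → Consistent R
      stepConsistent⇒consistent pres ε RC = RC
      stepConsistent⇒consistent pres (_◅_ {i = S , C} {S′ , C′} (send-step i β _ b t S→S′ at-β elsewhere) steps) RC =
        stepConsistent⇒consistent pres steps
          -- The step determines `C′` channel by channel, so the modified content agrees with it
          -- pointwise, and saturation transfers `R S′`.
          (respects-≡ (F S′) (modifyAt-unique β (_∷ʳ b) C C′ at-β elsewhere)
            (ListAll.lookup (pres S S′ i) t refl refl S→S′ C RC))
      stepConsistent⇒consistent pres (_◅_ {i = S , C} {S′ , C′} (recv-step i β _ b t S→S′ at-β elsewhere) steps) RC =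
        stepConsistent⇒consistent pres steps
          -- The roles are reversed for a receive: the test is made at `C′`, and prepending `b`
          -- there recovers `C`.
          (ListAll.lookup (pres S S′ i) t refl refl S→S′ C′
            (respects-≡ (F S) (λ ξ → sym (modifyAt-unique β (b ∷_) C′ C at-β (λ k k≢β → sym (elsewhere k k≢β)) ξ)) RC))

    -- Every instance of the test describes a genuine step of the protocol, to which consistency
    -- applies as a run of length one.
    consistent⇒stepConsistent : Consistent R → StepConsistent
    consistent⇒stepConsistent cons S S′ i = ListAll.tabulate λ {(p , α , q)} → preserves p α q
      where
      preserves : ∀ p α q → (p , α , q) ∈ₗ T i → TransitionPreserves i S S′ (p , α , q)
      preserves _ (send β e b) _ t refl refl S→S′ C =
        cons (send-step i β e b t S→S′ (content-modifyAt β (_∷ʳ b) C) (modifyAt-unchanged β (_∷ʳ b) C) ◅ ε)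
      preserves _ (recv β e b) _ t refl refl S→S′ C =
        cons (recv-step i β e b t S→S′ (content-modifyAt β (b ∷_) C)
          (λ k k≢β → sym (modifyAt-unchanged β (b ∷_) C k k≢β)) ◅ ε)

theorem9p4 : (P : Protocol) → let open Protocol P in
    (R : CompositeState → ChannelRelation) →
    (∀ S → Recognizable (R S)) →
    Dec (Consistent R)
theorem9p4 P R rec = map′ (stepConsistent⇒consistent P R F) (consistent⇒stepConsistent P R) (stepConsistent? P R F)
  where
  F : ∀ S → FiniteIndex (R S)
  F S = recognizable⇒finiteIndex P (rec S)
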